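{- For all positive integers $n,m$, the second player wins the Peaceable Bishops Game $\mathrm{PB}(n,m)$ if and only if at least one of $n$ and $m$ is even.
   Context: The Peaceable Bishops Game $\mathrm{PB}(n,m)$ is played on an $n\times m$ chessboard with squares $(x,y)$, $0\leq x\leq n-1$, $0\leq y\leq m-1$. Two players alternately place a bishop on an unoccupied square; the first player places white bishops and the second player places black bishops. A player may not place a bishop on a square within attacking range of a bishop previously placed by the opponent. A player unable to move on their turn loses. Two distinct squares $(x_1,y_1)$ and $(x_2,y_2)$ are within attacking range for bishops iff $|x_1-x_2|=|y_1-y_2|$ (regardless of any pieces standing between them). A player "wins" the game if that player has a winning strategy. -}

module Defs where

open import Data.Fin using (Fin; toℕ)
open import Data.List using (List; []; _∷_)
open import Data.List.Relation.Unary.All using (All)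
open import Data.Nat using (ℕ; ∣_-_∣)
open import Data.Product using (_×_; _,_; proj₂; ∃; Σ-syntax)
open import Relation.Binary.PropositionalEquality using (_≡_; _≢_)
open import Relation.Nullary using (¬_)

-- The first player owns the white bishops, the second player the black ones.
data Player : Set where
  first second : Player

opponent : Player → Player
opponent first  = second
opponent second = first

module _ (n m : ℕ) where

  Square : Set
  Square = Fin n × Fin m

  Attacks : Square → Square → Set
  Attacks s@(x₁ , y₁) t@(x₂ , y₂) =
    s ≢ t × ∣ toℕ x₁ - toℕ x₂ ∣ ≡ ∣ toℕ y₁ - toℕ y₂ ∣

  -- The bishops are listed with their owners, most recently placed first, so a
  -- position reached in play records the whole history of the game.
  record Position : Set where
    constructor position
    field
      toMove  : Player
      bishops : List (Player × Square)

  open Position public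

  start : Position
  start = position first []

  Legal : Position → Square → Set
  Legal p s =
      All (λ b → proj₂ b ≢ s) (bishops p)
    × All (λ (owner , t) → owner ≡ opponent (toMove p) → ¬ Attacks t s) (bishops p)

  place : Position → Square → Position
  place p s = position (opponent (toMove p)) ((toMove p , s) ∷ bishops p)

  Stuck : Position → Set
  Stuck p = ¬ ∃ (Legal p)

  -- The value of `choose` is irrelevant where P is not to move or cannot move.
  record Strategy (P : Player) : Set where
    field
      choose : Position → Square
      legal  : ∀ p → toMove p ≡ P → ∃ (Legal p) → Legal p (choose p)

  open Strategy public

  -- The positions arising in plays from the start in which P follows σ and the
  -- opponent makes arbitrary legal moves.
  data Reachable {P : Player} (σ : Strategy P) : Position → Set where
    initial : Reachable σ start
    step    : ∀ {p s} → Reachable σ p → Legal p s →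
              (toMove p ≡ P → s ≡ choose σ p) → Reachable σ (place p s)

  -- Each move fills a new square, so every play ends in a stuck position, and is
  -- lost by the player then to move.  Hence σ wins all plays following it
  -- exactly when P is never the one to move in a stuck position.
  Winning : ∀ {P} → Strategy P → Set
  Winning {P} σ = ∀ p → Reachable σ p → Stuck p → toMove p ≡ opponent P

  Wins : Player → Set
  Wins P = Σ[ σ ∈ Strategy P ] Winning σ

{-# OPTIONS --safe #-}
-- A player who can always answer an enemy bishop on s by a bishop on f s, for an
-- attack-preserving involution f of the board, never gets stuck: if f s were
-- occupied or attacked, s would have been so by symmetry, unless s itself blocks
-- f s.  If a side is even, the reflection reversing it never maps a square to
-- itself or to an attacked one, so the second player wins.  If both sides are
-- odd, f is the half turn, and s can block f s only when s is the central square
-- or on one of its diagonals; the first player rules this out by opening in the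
-- centre.  The two players cannot both win, because every play is finite.
module Submission where

open import Data.Fin using (Fin; zero; suc; toℕ; fromℕ<; opposite; combine)
open import Data.Fin.Properties
  using (toℕ<n; toℕ-injective; toℕ-fromℕ<; opposite-prop; opposite-involutive; any?;
    combine-injective; injective⇒≤)
  renaming (_≟_ to _≟ᶠ_)
open import Data.List using (List; []; _∷_; length; lookup)
open import Data.List.Membership.Propositional.Properties using (∈-lookup)
open import Data.List.Relation.Unary.All as All using (All; []; _∷_)
open import Data.List.Relation.Unary.AllPairs using (AllPairs; []; _∷_)
open import Data.Nat using (ℕ; zero; suc; NonZero; _+_; _*_; _≤_; s≤s; ∣_-_∣; >-nonZero⁻¹)
open import Data.Nat.Divisibility
  using (_∣_; divides; _∣?_; ∣-refl; _∣0; ∣m∣n⇒∣m+n; ∣m+n∣m⇒∣n; ∣1⇒≡1)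
open import Data.Nat.Properties
  using (_≟_; +-comm; +-suc; +-identityʳ; +-cancelˡ-≡; *-comm; *-cancelˡ-≡; suc-injective;
    m+[n∸m]≡n; m≤m+n; ≤-trans; ≤-reflexive; 1+n≰n; *-distribˡ-∣-∣;
    ∣m+n-m+o∣≡∣n-o∣; ∣-∣-comm; ∣n-n∣≡0; ∣m-n∣≡0⇒m≡n)
open import Data.Product using (_×_; _,_; proj₁; proj₂; ∃; ∃-syntax; map)
open import Data.Product.Properties using (≡-dec; ,-injectiveˡ; ,-injectiveʳ)
open import Data.Sum using (_⊎_; inj₁; inj₂)
open import Function using (_∘_; id)
open import Function.Bundles using (_⇔_; mk⇔)
open import Relation.Binary.PropositionalEquality
  using (_≡_; _≢_; refl; sym; trans; cong; cong₂; subst; module ≡-Reasoning)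
open import Relation.Nullary using (¬_; Dec; yes; no; ¬?; contradiction)
open import Relation.Nullary.Decidable using (_×-dec_; _→-dec_; map′)
open import Defs

-- Players and lists.

opponent-involutive : ∀ P → opponent (opponent P) ≡ P
opponent-involutive first  = refl
opponent-involutive second = refl

P≢opponent : ∀ P → P ≢ opponent P
P≢opponent first  ()
P≢opponent second ()

_≟ᴾ_ : (P Q : Player) → Dec (P ≡ Q)
first  ≟ᴾ first  = yes refl
first  ≟ᴾ second = no λ ()
second ≟ᴾ first  = no λ ()
second ≟ᴾ second = yes refl

own-or-opponent : ∀ P Q → Q ≡ P ⊎ Q ≡ opponent P
own-or-opponent first  first  = inj₁ refl
own-or-opponent first  second = inj₂ refl
own-or-opponent second first  = inj₂ refl
own-or-opponent second second = inj₁ refl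

-- The inequality is oriented as in `Legal`, later list entry on the left, so that `Distinct` grows
-- by the first half of a legal move.
lookup-injective : ∀ {A B : Set} (f : A → B) {xs : List A} →
  AllPairs (λ x y → f y ≢ f x) xs →
  ∀ {i j} → f (lookup xs i) ≡ f (lookup xs j) → i ≡ j
lookup-injective f (_ ∷ _)   {zero}  {zero}  _  = refl
lookup-injective f (x# ∷ _)  {zero}  {suc j} eq =
  contradiction (sym eq) (All.lookup x# (∈-lookup j))
lookup-injective f (x# ∷ _)  {suc i} {zero}  eq =
  contradiction eq (All.lookup x# (∈-lookup i))
lookup-injective f (_ ∷ xs#) {suc i} {suc j} eq =
  cong suc (lookup-injective f xs# eq)

-- Distances and the reflection of a segment.

∣-∣-complement : ∀ a a′ b b′ → a + a′ ≡ b + b′ → ∣ a - b ∣ ≡ ∣ a′ - b′ ∣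
∣-∣-complement a a′ b b′ eq = begin
  ∣ a - b ∣            ≡⟨ ∣m+n-m+o∣≡∣n-o∣ a′ a b ⟨
  ∣ a′ + a - a′ + b ∣  ≡⟨ cong₂ ∣_-_∣ (trans (+-comm a′ a) eq) (+-comm a′ b) ⟩
  ∣ b + b′ - b + a′ ∣  ≡⟨ ∣m+n-m+o∣≡∣n-o∣ b b′ a′ ⟩
  ∣ b′ - a′ ∣          ≡⟨ ∣-∣-comm b′ a′ ⟩
  ∣ a′ - b′ ∣          ∎
  where open ≡-Reasoning

-- As `h` is the midpoint of `a` and `a′`, adding `a` to both terms gives a distance between
-- doubles.
∣-∣-midpoint : ∀ a a′ h → a + a′ ≡ h + h → ∣ a - a′ ∣ ≡ 2 * ∣ h - a ∣
∣-∣-midpoint a a′ h eq = begin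
  ∣ a - a′ ∣           ≡⟨ ∣m+n-m+o∣≡∣n-o∣ a a a′ ⟨
  ∣ a + a - a + a′ ∣   ≡⟨ cong (∣ a + a -_∣) eq ⟩
  ∣ a + a - h + h ∣    ≡⟨ ∣-∣-comm (a + a) (h + h) ⟩
  ∣ h + h - a + a ∣    ≡⟨ cong₂ ∣_-_∣ (double h) (double a) ⟨
  ∣ 2 * h - 2 * a ∣    ≡⟨ *-distribˡ-∣-∣ 2 h a ⟨
  2 * ∣ h - a ∣        ∎
  where
  open ≡-Reasoning
  double : ∀ k → 2 * k ≡ k + k
  double k = cong (k +_) (+-identityʳ k)

half : ∀ n → ¬ 2 ∣ n → ∃[ h ] suc (h + h) ≡ n
half zero          2∤n = contradiction (2 ∣0) 2∤n
half (suc zero)    2∤n = 0 , refl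
half (suc (suc n)) 2∤n with half n (2∤n ∘ ∣m∣n⇒∣m+n ∣-refl)
... | h , refl = suc h , cong (λ k → suc (suc k)) (+-suc h h)

opposite-sum : ∀ {n} (i : Fin n) → suc (toℕ i + toℕ (opposite i)) ≡ n
opposite-sum i = trans (cong (suc (toℕ i) +_) (opposite-prop i)) (m+[n∸m]≡n (toℕ<n i))

opposite-sums : ∀ {n} (i j : Fin n) → toℕ i + toℕ (opposite i) ≡ toℕ j + toℕ (opposite j)
opposite-sums i j = suc-injective (trans (opposite-sum i) (sym (opposite-sum j)))

opposite-isometric : ∀ {n} (i j : Fin n) →
  ∣ toℕ (opposite i) - toℕ (opposite j) ∣ ≡ ∣ toℕ i - toℕ j ∣
opposite-isometric i j = sym (∣-∣-complement
  (toℕ i) (toℕ (opposite i)) (toℕ j) (toℕ (opposite j)) (opposite-sums i j))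

-- A fixed point would make `n` one more than a double, so 2 would divide 1.
opposite≢ : ∀ {n} → 2 ∣ n → (i : Fin n) → opposite i ≢ i
opposite≢ {n} 2∣n i fixed = contradiction (∣1⇒≡1 2∣1) λ ()
  where
  2∣i+i : 2 ∣ toℕ i + toℕ i
  2∣i+i = divides (toℕ i) (trans (cong (toℕ i +_) (sym (+-identityʳ (toℕ i)))) (*-comm 2 (toℕ i)))
  i+i+1≡n : toℕ i + toℕ i + 1 ≡ n
  i+i+1≡n = trans (+-comm _ 1) (subst (λ j → suc (toℕ i + toℕ j) ≡ n) fixed (opposite-sum i))
  2∣1 : 2 ∣ 1
  2∣1 = ∣m+n∣m⇒∣n (subst (2 ∣_) (sym i+i+1≡n) 2∣n) 2∣i+i

centre : ∀ {n} → ¬ 2 ∣ n → ∃[ h ] opposite {n} h ≡ h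
centre {n} 2∤n with half n 2∤n
... | h , h+h+1≡n = i , toℕ-injective (+-cancelˡ-≡ (toℕ i) _ _ (suc-injective (begin
  suc (toℕ i + toℕ (opposite i))  ≡⟨ opposite-sum i ⟩
  n                               ≡⟨ h+h+1≡n ⟨
  suc (h + h)                     ≡⟨ cong (λ k → suc (k + k)) i≡h ⟨
  suc (toℕ i + toℕ i)             ∎)))
  where
  open ≡-Reasoning
  h<n = ≤-trans (s≤s (m≤m+n h h)) (≤-reflexive h+h+1≡n)
  i = fromℕ< h<n
  i≡h : toℕ i ≡ h
  i≡h = toℕ-fromℕ< h<n

-- The fixed point is the midpoint of `i` and its image. The factor 2 is the same along both axes of
-- the board, so it cancels when the two distances are compared.
opposite-distance : ∀ {n} {h : Fin n} → opposite h ≡ h → ∀ i →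
  ∣ toℕ i - toℕ (opposite i) ∣ ≡ 2 * ∣ toℕ h - toℕ i ∣
opposite-distance {h = h} fixed i = ∣-∣-midpoint (toℕ i) (toℕ (opposite i)) (toℕ h)
  (trans (opposite-sums i h) (cong (λ j → toℕ h + toℕ j) fixed))

-- The distance from `i` to its image is zero, and it is twice the distance from `h` to `i`.
opposite-fixed-unique : ∀ {n} {h i : Fin n} → opposite h ≡ h → opposite i ≡ i → h ≡ i
opposite-fixed-unique {h = h} {i} fixed fixed′ = toℕ-injective (∣m-n∣≡0⇒m≡n
  (*-cancelˡ-≡ _ 0 2 (trans (sym (opposite-distance fixed i))
    (subst (λ j → ∣ toℕ i - toℕ j ∣ ≡ 0) (sym fixed′) (∣n-n∣≡0 (toℕ i))))))

-- Decidable moves, and strategies from invariants.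

module _ {n m : ℕ} where

  _≟ˢ_ : (s t : Square n m) → Dec (s ≡ t)
  _≟ˢ_ = ≡-dec _≟ᶠ_ _≟ᶠ_

  attacks? : (s t : Square n m) → Dec (Attacks n m s t)
  attacks? s@(x₁ , y₁) t@(x₂ , y₂) =
    ¬? (s ≟ˢ t) ×-dec ∣ toℕ x₁ - toℕ x₂ ∣ ≟ ∣ toℕ y₁ - toℕ y₂ ∣

  legal? : ∀ p s → Dec (Legal n m p s)
  legal? p s =
    All.all? (λ b → ¬? (proj₂ b ≟ˢ s)) (bishops p) ×-dec
    All.all? (λ (owner , t) → (owner ≟ᴾ opponent (toMove p)) →-dec ¬? (attacks? t s)) (bishops p)

  legalMove? : ∀ p → Dec (∃ (Legal n m p))
  legalMove? p = map′
    (λ (x , y , l) → (x , y) , l) (λ ((x , y) , l) → x , y , l)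
    (any? λ x → any? λ y → legal? p (x , y))

  module _ (reply : Position n m → Square n m) where

    -- A `Strategy` must be legal wherever its player can move, even off the intended plays. Where
    -- `reply` is illegal, a legal move found by search replaces it.
    preferred : Position n m → Square n m
    preferred p with legal? p (reply p) | legalMove? p
    ... | yes _ | _           = reply p
    ... | no _  | yes (s , _) = s
    ... | no _  | no _        = reply p

    preferred-legal : ∀ p → ∃ (Legal n m p) → Legal n m p (preferred p)
    preferred-legal p move with legal? p (reply p) | legalMove? p
    ... | yes l | _           = l
    ... | no _  | yes (_ , l) = l
    ... | no _  | no stuck    = contradiction move stuck

    preferred≡reply : ∀ p → Legal n m p (reply p) → preferred p ≡ reply p
    preferred≡reply p l with legal? p (reply p) | legalMove? p
    ... | yes _ | _ = refl
    ... | no ¬l | _ = contradiction l ¬l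

    prefer : ∀ P → Strategy n m P
    prefer P = record { choose = preferred ; legal = λ p _ → preferred-legal p }

    wins-by-invariant : ∀ P (Good : Position n m → Set) →
      Good (start n m) →
      (∀ {p} → toMove p ≡ P → Good p → Legal n m p (reply p) × Good (place n m p (reply p))) →
      (∀ {p s} → toMove p ≡ opponent P → Good p → Legal n m p s → Good (place n m p s)) →
      Wins n m P
    wins-by-invariant P Good good-start own other = prefer P , winning
      where
      good : ∀ {p} → Reachable n m (prefer P) p → Good p
      good initial = good-start
      good (step {p} r l follows) with own-or-opponent P (toMove p)
      ... | inj₂ theirs = other theirs (good r) l
      ... | inj₁ mine with own mine (good r)
      -- Since `reply` is legal here, the move played is `reply` itself and not the fallback.
      ...   | legal-reply , good-reply = subst (Good ∘ place n m p)
              (sym (trans (follows mine) (preferred≡reply p legal-reply))) good-reply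

      winning : Winning n m (prefer P)
      winning p r stuck with own-or-opponent P (toMove p)
      ... | inj₂ theirs = theirs
      ... | inj₁ mine   = contradiction (_ , proj₁ (own mine (good r))) stuck

  -- The mirroring strategy.

  opening : Player → Square n m → List (Player × Square n m)
  opening first  c = (first , c) ∷ []
  opening second c = []

  opening-owner : ∀ P c → All (λ b → proj₁ b ≡ P) (opening P c)
  opening-owner first  c = refl ∷ []
  opening-owner second c = []

  module Mirroring
    (P : Player) (c : Square n m) (f : Square n m → Square n m)
    (f-involutive : ∀ s → f (f s) ≡ s)
    (f-attacks : ∀ {s t} → Attacks n m s t → Attacks n m (f s) (f t))
    (f-opening : All (λ b → f (proj₂ b) ≡ proj₂ b) (opening P c))
    -- The enemy bishop just placed could itself block its mirror image; the opening has to exclude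
    -- this.
    (f-safe : ∀ s → All (λ b → proj₂ b ≢ s × ¬ Attacks n m (proj₂ b) s) (opening P c) →
              s ≢ f s × ¬ Attacks n m s (f s))
    where

    f≢ : ∀ {s t} → f t ≢ s → t ≢ f s
    f≢ ft≢s refl = ft≢s (f-involutive _)

    ≢f : ∀ {s t} → t ≢ s → f t ≢ f s
    ≢f t≢s eq = t≢s (trans (sym (f-involutive _)) (trans (cong f eq) (f-involutive _)))

    f-attacks⁻ : ∀ {s t} → Attacks n m t (f s) → Attacks n m (f t) s
    f-attacks⁻ {s} {t} a = subst (Attacks n m (f t)) (f-involutive s) (f-attacks a)

    data Paired : List (Player × Square n m) → Set where
      base : Paired (opening P c)
      pair : ∀ {bs} s → Paired bs → Paired ((P , f s) ∷ (opponent P , s) ∷ bs)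

    theirTurn : List (Player × Square n m) → Position n m
    theirTurn = position (opponent P)

    -- The pairs are peeled off until the opening bishops remain, to which `f-safe` applies.
    legal⇒safe : ∀ {bs s} → Paired bs → Legal n m (theirTurn bs) s →
      s ≢ f s × ¬ Attacks n m s (f s)
    legal⇒safe {s = s} base (free , safe) = f-safe s
      (All.zipWith (λ (owner≡P , free , safe) →
          free , safe (trans owner≡P (sym (opponent-involutive P))))
        (opening-owner P c , All.zip (free , safe)))
    legal⇒safe (pair _ bs) (_ ∷ _ ∷ free , _ ∷ _ ∷ safe) = legal⇒safe bs (free , safe)

    -- The occupied squares are closed under `f`: it swaps the squares of each pair and fixes those
    -- of the opening.
    mirror-free : ∀ {bs s} → Paired bs →
      All (λ b → proj₂ b ≢ s) bs → All (λ b → proj₂ b ≢ f s) bs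
    mirror-free base free =
      All.zipWith (λ (fixed , t≢s) → subst (_≢ _) fixed (≢f t≢s)) (f-opening , free)
    mirror-free (pair _ bs) (ft≢s ∷ t≢s ∷ free) = ≢f t≢s ∷ f≢ ft≢s ∷ mirror-free bs free

    -- An enemy bishop on `t` attacking `f s` has a partner of `P` on `f t`, which would attack `s`;
    -- the legality of the enemy move to `s` excludes that. Opening bishops belong to `P`.
    mirror-safe : ∀ {bs s} → Paired bs →
      All (λ (owner , t) → owner ≡ opponent (opponent P) → ¬ Attacks n m t s) bs →
      All (λ (owner , t) → owner ≡ opponent P → ¬ Attacks n m t (f s)) bs
    mirror-safe base _ = All.map
      (λ owner≡P owner≡O _ → P≢opponent P (trans (sym owner≡P) owner≡O)) (opening-owner P c)
    mirror-safe (pair _ bs) (¬a ∷ _ ∷ safe) =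
      (λ P≡O _ → P≢opponent P P≡O) ∷
      (λ _ a → ¬a (sym (opponent-involutive P)) (f-attacks⁻ a)) ∷
      mirror-safe bs safe

    -- Three phases: the empty board before `P` opens, the enemy to move with all its bishops
    -- answered, and `P` to move with one unanswered. The last keeps the legality of the enemy move,
    -- from which that of the answer is derived.
    data Mirrored : Position n m → Set where
      opens   : P ≡ first → Mirrored (start n m)
      theirs  : ∀ {bs} → Paired bs → Mirrored (theirTurn bs)
      replies : ∀ {bs s} → Paired bs → Legal n m (theirTurn bs) s →
                Mirrored (position P ((opponent P , s) ∷ bs))

    -- The empty board occurs on P's turn only if P opens the game, with c.
    reply : Position n m → Square n m
    reply (position _ [])            = c
    reply (position _ ((_ , s) ∷ _)) = f s

    mirrored-start : ∀ Q → Q ≡ P → Mirrored (start n m)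
    mirrored-start first  eq   = opens (sym eq)
    -- For `second` the opening is empty, so the start is already a paired position.
    mirrored-start second refl = theirs base

    own : ∀ {p} → toMove p ≡ P → Mirrored p →
      Legal n m p (reply p) × Mirrored (place n m p (reply p))
    own _    (opens refl) = ([] , []) , theirs base
    own mine (theirs _)   = contradiction (sym mine) (P≢opponent P)
    own _    (replies {s = s} bs l@(free , safe)) with legal⇒safe bs l
    ... | s≢fs , ¬a =
      (s≢fs ∷ mirror-free bs free , (λ _ → ¬a) ∷ mirror-safe bs safe) , theirs (pair s bs)

    other : ∀ {p s} → toMove p ≡ opponent P → Mirrored p → Legal n m p s →
      Mirrored (place n m p s)
    other () (opens refl)
    other {s = s} _ (theirs {bs} bs-paired) l =
      subst (λ Q → Mirrored (position Q ((opponent P , s) ∷ bs)))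
        (sym (opponent-involutive P)) (replies bs-paired l)
    other eq (replies _ _) _ = contradiction eq (P≢opponent P)

    wins : Wins n m P
    wins = wins-by-invariant reply P Mirrored (mirrored-start P refl) own other

  -- Reflections of the board.

  isometric-attacks : ∀ {g : Fin n → Fin n} {h : Fin m → Fin m} →
    (∀ i → g (g i) ≡ i) → (∀ i → h (h i) ≡ i) →
    (∀ i j → ∣ toℕ (g i) - toℕ (g j) ∣ ≡ ∣ toℕ i - toℕ j ∣) →
    (∀ i j → ∣ toℕ (h i) - toℕ (h j) ∣ ≡ ∣ toℕ i - toℕ j ∣) →
    ∀ {s t} → Attacks n m s t → Attacks n m (map g h s) (map g h t)
  isometric-attacks {g} {h} gg hh g-iso h-iso {x₁ , y₁} {x₂ , y₂} (s≢t , eq) =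
    -- An involution is injective, so distinct squares stay distinct.
    (λ e → s≢t (cong₂ _,_ (cancel gg (,-injectiveˡ e)) (cancel hh (,-injectiveʳ e)))) ,
    trans (g-iso x₁ x₂) (trans eq (sym (h-iso y₁ y₂)))
    where
    cancel : ∀ {k} {r : Fin k → Fin k} → (∀ i → r (r i) ≡ i) → ∀ {i j} → r i ≡ r j → i ≡ j
    cancel {r = r} rr {i} {j} e = trans (sym (rr i)) (trans (cong r e) (rr j))

  second-wins-even-width : Square n m → 2 ∣ n → Wins n m second
  second-wins-even-width c 2∣n = Mirroring.wins second c (map opposite id)
    (λ (x , _) → cong (_, _) (opposite-involutive x))
    (isometric-attacks opposite-involutive (λ _ → refl) opposite-isometric (λ _ _ → refl))
    []
    λ (x , y) _ →
      (λ eq → opposite≢ 2∣n x (sym (,-injectiveˡ eq))) ,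
      -- A square and its image share the second coordinate, so an attack would make the first
      -- coordinates equal too.
      (λ (_ , eq) → opposite≢ 2∣n x (sym (toℕ-injective
        (∣m-n∣≡0⇒m≡n (trans eq (∣n-n∣≡0 (toℕ y)))))))

  second-wins-even-height : Square n m → 2 ∣ m → Wins n m second
  second-wins-even-height c 2∣m = Mirroring.wins second c (map id opposite)
    (λ (_ , y) → cong (_ ,_) (opposite-involutive y))
    (isometric-attacks (λ _ → refl) opposite-involutive (λ _ _ → refl) opposite-isometric)
    []
    λ (x , y) _ →
      (λ eq → opposite≢ 2∣m y (sym (,-injectiveʳ eq))) ,
      (λ (_ , eq) → opposite≢ 2∣m y (sym (toℕ-injective
        (∣m-n∣≡0⇒m≡n (trans (sym eq) (∣n-n∣≡0 (toℕ x)))))))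

  first-wins-odd : ¬ 2 ∣ n → ¬ 2 ∣ m → Wins n m first
  first-wins-odd 2∤n 2∤m with centre 2∤n | centre 2∤m
  ... | h , h-fixed | k , k-fixed = Mirroring.wins first (h , k) (map opposite opposite)
    (λ (x , y) → cong₂ _,_ (opposite-involutive x) (opposite-involutive y))
    (isometric-attacks opposite-involutive opposite-involutive opposite-isometric opposite-isometric)
    (cong₂ _,_ h-fixed k-fixed ∷ [])
    λ { (x , y) ((c≢s , ¬a) ∷ []) →
      (λ eq → c≢s (cong₂ _,_ (opposite-fixed-unique h-fixed (sym (,-injectiveˡ eq)))
                             (opposite-fixed-unique k-fixed (sym (,-injectiveʳ eq))))) ,
      -- Halving both distances turns an attack between `(x , y)` and its image into an attack on
      -- `(x , y)` from the centre, where the opening bishop stands.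
      (λ (_ , eq) → ¬a (c≢s , *-cancelˡ-≡ _ _ 2
        (trans (sym (opposite-distance h-fixed x)) (trans eq (opposite-distance k-fixed y))))) }

  -- Finiteness of plays.

  Distinct : Position n m → Set
  Distinct p = AllPairs (λ b b′ → proj₂ b′ ≢ proj₂ b) (bishops p)

  -- Pigeonhole, with the squares numbered by `combine`.
  distinct⇒bounded : ∀ p → Distinct p → length (bishops p) ≤ n * m
  distinct⇒bounded p distinct = injective⇒≤ {f = index} λ {i} {j} eq →
    lookup-injective proj₂ distinct (index-injective _ _ eq)
    where
    cell : Square n m → Fin (n * m)
    cell (x , y) = combine x y
    index : Fin (length (bishops p)) → Fin (n * m)
    index i = cell (proj₂ (lookup (bishops p) i))
    index-injective : ∀ s t → cell s ≡ cell t → s ≡ t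
    index-injective (x , y) (x′ , y′) eq with combine-injective x y x′ y′ eq
    ... | refl , refl = refl

  -- The two strategies play each other. In a stuck position each would claim that the other player
  -- is to move, so the play goes on until it outgrows the board.
  not-both-win : Wins n m first → ¬ Wins n m second
  not-both-win (σ , σ-wins) (τ , τ-wins) with play (suc (n * m))
    where
    play : ∀ k → ∃[ p ] length (bishops p) ≡ k × Distinct p
                      × Reachable n m σ p × Reachable n m τ p
    play zero = start n m , refl , [] , initial , initial
    play (suc k) with play k
    ... | p@(position Q _) , refl , distinct , rσ , rτ with legalMove? p
    ...   | no stuck =
            contradiction (trans (sym (τ-wins p rτ stuck)) (σ-wins p rσ stuck)) λ ()
    play (suc k) | p@(position first _) , refl , distinct , rσ , rτ | yes move =
      let l = legal σ p refl move in
      place n m p (choose σ p) , refl , proj₁ l ∷ distinct ,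
      -- It is the first player's turn, so `τ` imposes nothing on this move.
      step rσ l (λ _ → refl) , step rτ l λ ()
    play (suc k) | p@(position second _) , refl , distinct , rσ , rτ | yes move =
      let l = legal τ p refl move in
      place n m p (choose τ p) , refl , proj₁ l ∷ distinct ,
      step rσ l (λ ()) , step rτ l λ _ → refl
  ... | p , len , distinct , _ = 1+n≰n (subst (_≤ n * m) len (distinct⇒bounded p distinct))

theorem5p3 : (n m : ℕ) → .{{_ : NonZero n}} → .{{_ : NonZero m}} →
    Wins n m second ⇔ (2 ∣ n ⊎ 2 ∣ m)
theorem5p3 n m = mk⇔ onlyIf λ where
    (inj₁ 2∣n) → second-wins-even-width corner 2∣n
    (inj₂ 2∣m) → second-wins-even-height corner 2∣m
  where
  -- Both sides are positive, so the board has a square to serve as the value of `reply` on the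
  -- empty board.
  corner : Square n m
  corner = fromℕ< (>-nonZero⁻¹ n) , fromℕ< (>-nonZero⁻¹ m)

  onlyIf : Wins n m second → 2 ∣ n ⊎ 2 ∣ m
  onlyIf w with 2 ∣? n | 2 ∣? m
  ... | yes 2∣n | _       = inj₁ 2∣n
  ... | no _    | yes 2∣m = inj₂ 2∣m
  ... | no 2∤n  | no 2∤m  = contradiction w (not-both-win (first-wins-odd 2∤n 2∤m))
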